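{- Let $k\ge 2$ and let $x_1, x_2, \ldots, x_{c}$ be the Nyldon factorization of $\mathit{TM}_{2k-1}$ (so $c$ is its number of factors). Then the Nyldon factorization of $\mathit{TM}_{2k}$ is $$x_1,\ \ldots,\ x_{c-1},\ x_{c}\cdot\overline{\mathit{TM}_{2k-2}}',\ b\cdot \mathit{TM}_{2k-2},$$ and the Nyldon factorization of $\mathit{TM}_{2k+1}$ is $$x_1,\ \ldots,\ x_{c-1},\ x_{c}\cdot\overline{\mathit{TM}_{2k-2}}',\ b\cdot \mathit{TM}_{2k-2}\cdot\overline{\mathit{TM}_{2k}}.$$ (For instance, the Nyldon factorization of $\mathit{TM}_3$ is $a,b,ba,baab$.)
   Context: Strings are over the binary alphabet $\{a,b\}$ ordered by $a \prec b$, and $\prec$ also denotes the induced lexicographic order on strings: $x \prec y$ iff $x$ is a proper prefix of $y$, or there is $i$ with $x[1..i-1]=y[1..i-1]$ and $x[i]\prec y[i]$; $x\preceq y$ means $x\prec y$ or $x=y$. Nyldon words are defined recursively: every string of length $1$ is a Nyldon word; a string $w$ with $|w|\ge 2$ is a Nyldon word iff there is no factorization $w=\gamma_1\cdots\gamma_m$ with $m\ge 2$, each $\gamma_i$ a nonempty Nyldon word, and $\gamma_1\preceq\gamma_2\preceq\cdots\preceq\gamma_m$. Every nonempty string $w$ has a unique factorization $w=\gamma_1\cdots\gamma_m$ into Nyldon words with $\gamma_i\preceq\gamma_{i+1}$ for all $i$; it is called the Nyldon factorization of $w$. For a binary string $w$, $\overline{w}$ is obtained by exchanging $a$ and $b$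 letterwise, and $w'=w[1..|w|-1]$ is $w$ with its last letter removed; $\overline{w}'$ means $(\overline{w})'$. Thue–Morse words: $\mathit{TM}_0=a$ and $\mathit{TM}_k=\mathit{TM}_{k-1}\cdot\overline{\mathit{TM}_{k-1}}$ for $k\ge1$. -}

module Defs where

open import Data.Bool.Base using (Bool; true; false; not) renaming (_<_ to _<ᴸ_)
open import Data.List.Base using (List; []; _∷_; _++_; [_]; concat; length; map; take)
open import Data.List.Properties using (length-++)
open import Data.List.Relation.Binary.Lex.Strict using (Lex-<)
open import Data.List.Relation.Unary.All as All using (All; []; _∷_)
open import Data.List.Relation.Unary.Linked using (Linked)
open import Data.Nat.Base using (ℕ; zero; suc; _∸_; _≤_; _<_; z≤n; s≤s)
open import Data.Nat.Induction using (<-wellFounded)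
open import Data.Nat.Properties using (≤-trans; m≤m+n; m≤n+m; m<m+n; +-mono-≤)
open import Data.Product.Base using (Σ-syntax; ∃-syntax; _×_; _,_)
open import Data.Sum.Base using (_⊎_; inj₁; inj₂)
open import Function.Bundles using (_⇔_; mk⇔)
open import Induction.WellFounded using (Acc; acc)
open import Relation.Binary.PropositionalEquality.Core using (_≡_; refl)
open import Relation.Nullary.Negation using (¬_)

-- The only instance of the library's strict order on Bool is false < true,
-- so the letters are ordered by a < b.
pattern a = false
pattern b = true

Word : Set
Word = List Bool

infix 4 _≺_ _⪯_

_≺_ : Word → Word → Set
_≺_ = Lex-< _≡_ _<ᴸ_

_⪯_ : Word → Word → Set
x ⪯ y = x ≺ y ⊎ x ≡ y

record NondecreasingFactorization (P : Word → Set) (w : Word) (γs : List Word) : Set where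
  constructor mkFactorization
  field
    concat≡ : concat γs ≡ w
    factors : All P γs
    nondecr : Linked _⪯_ γs

open NondecreasingFactorization public

-- "w is Nyldon", by recursion on the length of w.  The bound on the length of
-- each factor is automatic when there are at least two nonempty factors; it is
-- there only to justify the recursive call (see Nyldon-unfold).
NyldonAcc : (w : Word) → Acc _<_ (length w) → Set
NyldonAcc w (acc rs) =
  length w ≡ 1 ⊎
  (2 ≤ length w ×
   ¬ (∃[ γs ] 2 ≤ length γs ×
      NondecreasingFactorization
        (λ γ → Σ[ γ<w ∈ length γ < length w ] NyldonAcc γ (rs γ<w)) w γs))

Nyldon : Word → Set
Nyldon w = NyldonAcc w (<-wellFounded (length w))

NyldonFactorization : Word → List Word → Set
NyldonFactorization = NondecreasingFactorization Nyldon

complement : Word → Word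
complement = map not

dropLast : Word → Word
dropLast w = take (length w ∸ 1) w

TM : ℕ → Word
TM zero    = [ a ]
TM (suc k) = TM k ++ complement (TM k)

NyldonAcc-irr : ∀ w (p q : Acc _<_ (length w)) → NyldonAcc w p → NyldonAcc w q
NyldonAcc-irr w (acc rs) (acc ss) (inj₁ eq) = inj₁ eq
NyldonAcc-irr w (acc rs) (acc ss) (inj₂ (2≤w , none)) =
  inj₂ (2≤w , λ (γs , 2≤γs , mkFactorization e all lk) →
    none (γs , 2≤γs , mkFactorization e
      (All.map (λ {γ} (lt , n) → lt , NyldonAcc-irr γ (ss lt) (rs lt) n) all) lk))

Nyldon⇒nonempty : ∀ w → Nyldon w → 0 < length w
Nyldon⇒nonempty (_ ∷ _) _ = s≤s z≤n
Nyldon⇒nonempty [] n = lemma (<-wellFounded 0) n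
  where
  lemma : (p : Acc _<_ 0) → NyldonAcc [] p → 0 < 0
  lemma (acc _) (inj₁ ())
  lemma (acc _) (inj₂ (() , _))

factor-≤ : (γs : List Word) → All (λ γ → length γ ≤ length (concat γs)) γs
factor-≤ [] = []
factor-≤ (γ ∷ γs) rewrite length-++ γ {concat γs} =
  m≤m+n _ _ ∷ All.map (λ le → ≤-trans le (m≤n+m _ (length γ))) (factor-≤ γs)

factor-< : (γs : List Word) → 2 ≤ length γs → All (λ γ → 0 < length γ) γs →
           All (λ γ → length γ < length (concat γs)) γs
factor-< (_ ∷ []) (s≤s ()) _
factor-< (γ ∷ δ ∷ γs) _ (0<γ ∷ 0<δ ∷ _)
  rewrite length-++ γ {δ ++ concat γs} =
    m<m+n (length γ) (≤-trans 0<δ (All.head (factor-≤ (δ ∷ γs))))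
  ∷ All.map (λ le → +-mono-≤ 0<γ le) (factor-≤ (δ ∷ γs))

Nyldon-unfold : ∀ w → Nyldon w ⇔
  (length w ≡ 1 ⊎
   (2 ≤ length w × ¬ (∃[ γs ] 2 ≤ length γs × NyldonFactorization w γs)))
Nyldon-unfold w = mk⇔ (to (<-wellFounded (length w))) (from (<-wellFounded (length w)))
  where
  Unfolded : Set
  Unfolded = length w ≡ 1 ⊎
    (2 ≤ length w × ¬ (∃[ γs ] 2 ≤ length γs × NyldonFactorization w γs))

  to : (p : Acc _<_ (length w)) → NyldonAcc w p → Unfolded
  to (acc rs) (inj₁ eq) = inj₁ eq
  to (acc rs) (inj₂ (2≤w , none)) =
    inj₂ (2≤w , λ { (γs , 2≤γs , mkFactorization refl all lk) →
      none (γs , 2≤γs , mkFactorization refl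
        (All.zipWith (λ {γ} (lt , n) →
            lt , NyldonAcc-irr γ (<-wellFounded (length γ)) (rs lt) n)
          (factor-< γs 2≤γs (All.map (λ {γ} → Nyldon⇒nonempty γ) all) , all)) lk) })

  from : (p : Acc _<_ (length w)) → Unfolded → NyldonAcc w p
  from (acc rs) (inj₁ eq) = inj₁ eq
  from (acc rs) (inj₂ (2≤w , none)) =
    inj₂ (2≤w , λ (γs , 2≤γs , mkFactorization e all lk) →
      none (γs , 2≤γs , mkFactorization e
        (All.map (λ {γ} (lt , n) →
          NyldonAcc-irr γ (rs lt) (<-wellFounded (length γ)) n) all) lk))

{-# OPTIONS --safe #-}
-- Nyldon words are the words with a standard factorization u v, where v ≺ u and
-- the right factor of u is ⪯ v; this gives uniqueness of the factorizations and
-- lets one certify Nyldon words by gluing.  Put T = TM (2m), complement T = D b,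
-- and consider B = bT, P = bTD, Z = bTTD, R = Z bD, Q = P bD, Ẑ = Z b.  From one m
-- to the next,
--   B' = Q·B,  P' = Q·(P·Z),  Z' = (Q·R)·(P·Z),  Ẑ' = (Q·R)·(P·Ẑ),
--   Q' = Q·(P·(R·Z)),  R' = (Q·R)·(P·(R·Z)),
-- and B ≺ Z ≺ Ẑ ≺ R ≺ P ≺ Q for m ≥ 1, so by induction all these products are
-- standard factorizations and all these words are Nyldon.  The last factor of
-- TM (2m + 3) is P·Ẑ, and P·Ẑ·D' = P·(R·Z).
module Submission where

open import Data.Bool.Base using (Bool; f<t)
import Data.Bool.Properties as Bool
open import Data.List.Base using (List; []; _∷_; _++_; [_]; _∷ʳ_; concat; length; take)
open import Data.List.Properties
  using (++-assoc; ++-identityʳ; ++-monoid; concat-++; length-++; map-++; map-∘; map-cong;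
         map-id; ∷ʳ-injective)
open import Data.List.Relation.Binary.Lex.Strict as Lex using (halt; this; next)
open import Data.List.Relation.Binary.Pointwise using (Pointwise-≡⇒≡; ≡⇒Pointwise-≡)
open import Data.List.Relation.Unary.All as All using (All; []; _∷_)
import Data.List.Relation.Unary.All.Properties as All
open import Data.List.Relation.Unary.Linked as Linked using (Linked; []; [-]; _∷_)
open import Data.Nat.Base using (ℕ; zero; suc; _+_; _*_; _∸_; _≤_; _<_; z≤n; s≤s)
open import Data.Nat.Induction using (<-wellFounded)
open import Data.Nat.Properties using (+-comm; +-mono-≤; +-suc; m+n∸n≡m)
open import Data.Product.Base using (∃-syntax; _×_; _,_; proj₁; proj₂)
open import Data.Sum.Base using (_⊎_; inj₁; inj₂)
open import Data.Unit.Base using (⊤; tt)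
open import Function.Bundles using (_⇔_; mk⇔; Equivalence)
open import Induction.WellFounded using (Acc; acc)
open import Relation.Binary.Definitions using (tri<; tri≈; tri>)
open import Relation.Binary.PropositionalEquality
  using (_≡_; refl; sym; trans; cong; cong₂; subst; resp₂; isEquivalence; module ≡-Reasoning)
open import Relation.Nullary.Negation using (¬_; contradiction)
open import Tactic.MonoidSolver using (solve)
open import Defs

factorization-resp : ∀ {F : Word → Set} {w w' γs} → w ≡ w' →
                     NondecreasingFactorization F w γs → NondecreasingFactorization F w' γs
factorization-resp refl f = f

-- Lexicographic order on words.

≺-trans : ∀ {u v w} → u ≺ v → v ≺ w → u ≺ w
≺-trans = Lex.<-transitive isEquivalence (resp₂ _) Bool.<-trans

≺-irrefl : ∀ {u} → ¬ u ≺ u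
≺-irrefl = Lex.<-irreflexive Bool.<-irrefl (≡⇒Pointwise-≡ refl)

≺-⪯-trans : ∀ {u v w} → u ≺ v → v ⪯ w → u ≺ w
≺-⪯-trans u≺v (inj₁ v≺w)  = ≺-trans u≺v v≺w
≺-⪯-trans u≺v (inj₂ refl) = u≺v

⪯-trans : ∀ {u v w} → u ⪯ v → v ⪯ w → u ⪯ w
⪯-trans (inj₁ u≺v)  v⪯w = inj₁ (≺-⪯-trans u≺v v⪯w)
⪯-trans (inj₂ refl) v⪯w = v⪯w

≺-or-⪰ : ∀ u v → v ≺ u ⊎ u ⪯ v
≺-or-⪰ u v with Lex.<-compare sym Bool.<-cmp u v
... | tri< u≺v _ _ = inj₂ (inj₁ u≺v)
... | tri≈ _ u≋v _ = inj₂ (inj₂ (Pointwise-≡⇒≡ u≋v))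
... | tri> _ _ v≺u = inj₁ v≺u

[]⪯ : ∀ w → [] ⪯ w
[]⪯ []      = inj₂ refl
[]⪯ (_ ∷ _) = inj₁ halt

∷-⪯ : ∀ c {u v} → u ⪯ v → c ∷ u ⪯ c ∷ v
∷-⪯ c (inj₁ u≺v)  = inj₁ (next refl u≺v)
∷-⪯ c (inj₂ refl) = inj₂ refl

⪯-++ : ∀ u v → u ⪯ u ++ v
⪯-++ []      v = []⪯ v
⪯-++ (c ∷ u) v = ∷-⪯ c (⪯-++ u v)

≺-++ : ∀ {u v} w → u ≺ v → u ≺ v ++ w
≺-++ {v = v} w u≺v = ≺-⪯-trans u≺v (⪯-++ v w)

≺-++-∷ : ∀ u c v → u ≺ u ++ c ∷ v
≺-++-∷ []      c v = halt
≺-++-∷ (_ ∷ u) c v = next refl (≺-++-∷ u c v)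

⪯-++-trans : ∀ {u v} w → u ⪯ v → u ⪯ v ++ w
⪯-++-trans {v = v} w u⪯v = ⪯-trans u⪯v (⪯-++ v w)

++⁺-≺ : ∀ w {u v} → u ≺ v → w ++ u ≺ w ++ v
++⁺-≺ []      u≺v = u≺v
++⁺-≺ (c ∷ w) u≺v = next refl (++⁺-≺ w u≺v)

-- Words with a standard factorization.

-- The index s is the right factor of w in its standard factorization, and []
-- when w is a letter.
data Hall : (s w : Word) → Set where
  letter : ∀ c → Hall [] [ c ]
  node   : ∀ {s u r v} → Hall s u → Hall r v → v ≺ u → s ⪯ v → Hall v (u ++ v)

IsHall : Word → Set
IsHall w = ∃[ s ] Hall s w

HallFactorization : Word → List Word → Set
HallFactorization = NondecreasingFactorization IsHall

Hall⇒suffix≺ : ∀ {s w} → Hall s w → s ≺ w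
Hall⇒suffix≺ (letter c)       = halt
Hall⇒suffix≺ (node _ _ v≺u _) = ≺-++ _ v≺u

Hall⇒nonempty : ∀ {s w} → Hall s w → 1 ≤ length w
Hall⇒nonempty (letter c) = s≤s z≤n
Hall⇒nonempty (node {u = []}    h _ _ _) = contradiction (Hall⇒nonempty h) λ ()
Hall⇒nonempty (node {u = _ ∷ _} _ _ _ _) = s≤s z≤n

-- Factorization by inserting letters from the right end.

-- The new word absorbs its right neighbour as long as that neighbour is smaller. Each absorption is
-- meant to be one `node`.
push : Word → List Word → List Word
push u []       = [ u ]
push u (v ∷ vs) with ≺-or-⪰ u v
... | inj₁ _ = push (u ++ v) vs
... | inj₂ _ = u ∷ v ∷ vs

factorize : Word → List Word
factorize []      = []
factorize (c ∷ w) = push [ c ] (factorize w)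

infix 4 _⪯head_

_⪯head_ : Word → List Word → Set
s ⪯head []      = ⊤
s ⪯head (v ∷ _) = s ⪯ v

linked-head : ∀ {v vs} → Linked _⪯_ (v ∷ vs) → v ⪯head vs
linked-head [-]       = tt
linked-head (v⪯v' ∷ _) = v⪯v'

⪯-⪯head-trans : ∀ {u v} vs → u ⪯ v → v ⪯head vs → u ⪯head vs
⪯-⪯head-trans []      _   _    = tt
⪯-⪯head-trans (_ ∷ _) u⪯v v⪯w = ⪯-trans u⪯v v⪯w

-- After a gluing the index of `u ++ v` is `v`, and `v` is at most the next factor because the list
-- is nondecreasing. So the precondition on the index reproduces itself.
push-correct : ∀ {s u w} vs → Hall s u → s ⪯head vs →
               HallFactorization w vs → HallFactorization (u ++ w) (push u vs)
push-correct [] h _ (mkFactorization refl _ _) =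
  mkFactorization refl ((_ , h) ∷ []) [-]
push-correct {u = u} (v ∷ vs) h s⪯v (mkFactorization refl ((_ , h') ∷ hs) lk)
  with ≺-or-⪰ u v
... | inj₁ v≺u = subst (λ w → HallFactorization w (push (u ++ v) vs))
                   (++-assoc u v (concat vs))
                   (push-correct vs (node h h' v≺u s⪯v) (linked-head lk)
                     (mkFactorization refl hs (Linked.tail lk)))
... | inj₂ u⪯v = mkFactorization refl ((_ , h) ∷ (_ , h') ∷ hs) (u⪯v ∷ lk)

[]⪯head : ∀ vs → [] ⪯head vs
[]⪯head []      = tt
[]⪯head (v ∷ _) = []⪯ v

factorize-correct : ∀ w → HallFactorization w (factorize w)
factorize-correct []      = mkFactorization refl [] []
factorize-correct (c ∷ w) = push-correct (factorize w) (letter c)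
  ([]⪯head (factorize w)) (factorize-correct w)

push-⪯ : ∀ {u} vs → u ⪯head vs → push u vs ≡ u ∷ vs
push-⪯ []               _   = refl
push-⪯ {u} (v ∷ vs) u⪯v with ≺-or-⪰ u v
... | inj₁ v≺u = contradiction (≺-⪯-trans v≺u u⪯v) ≺-irrefl
... | inj₂ _   = refl

push-≺ : ∀ {u v} vs → v ≺ u → push u (v ∷ vs) ≡ push (u ++ v) vs
push-≺ {u} {v} vs v≺u with ≺-or-⪰ u v
... | inj₁ _   = refl
... | inj₂ u⪯v = contradiction (≺-⪯-trans v≺u u⪯v) ≺-irrefl

-- Uniqueness of the factorization.

-- Induction on the standard factorization: the bound on the index keeps the right factor `v` from
-- absorbing anything of `w`, so `v` is still a separate factor when `u` arrives, and `u` absorbs it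
-- because `v ≺ u`.
factorize-++ : ∀ {s u} → Hall s u → ∀ w → s ⪯head factorize w →
               factorize (u ++ w) ≡ push u (factorize w)
factorize-++ (letter c) w _ = refl
factorize-++ (node {s} {u} {r} {v} hu hv v≺u s⪯v) w v⪯w = begin
  factorize ((u ++ v) ++ w)         ≡⟨ cong factorize (++-assoc u v w) ⟩
  factorize (u ++ v ++ w)           ≡⟨ factorize-++ hu (v ++ w) (subst (s ⪯head_) (sym eq) s⪯v) ⟩
  push u (factorize (v ++ w))       ≡⟨ cong (push u) eq ⟩
  push u (v ∷ factorize w)          ≡⟨ push-≺ (factorize w) v≺u ⟩
  push (u ++ v) (factorize w)       ∎
  where
  open ≡-Reasoning
  -- The index of `v` is smaller than `v`, so the bound on `v` also bounds that index and the
  -- induction hypothesis applies.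
  eq : factorize (v ++ w) ≡ v ∷ factorize w
  eq = trans
    (factorize-++ hv w
      (⪯-⪯head-trans (factorize w) (inj₁ (Hall⇒suffix≺ hv)) v⪯w))
    (push-⪯ (factorize w) v⪯w)

-- Being recovered from its concatenation by a function, such a list is determined by the word; this
-- is the source of uniqueness.
factorize-concat : ∀ vs → All IsHall vs → Linked _⪯_ vs → factorize (concat vs) ≡ vs
factorize-concat []       _              _  = refl
factorize-concat (v ∷ vs) ((s , h) ∷ hs) lk = begin
  factorize (v ++ concat vs)       ≡⟨ factorize-++ h (concat vs) (subst (s ⪯head_) (sym eq) s⪯vs) ⟩
  push v (factorize (concat vs))   ≡⟨ cong (push v) eq ⟩
  push v vs                        ≡⟨ push-⪯ vs (linked-head lk) ⟩
  v ∷ vs                           ∎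
  where
  open ≡-Reasoning
  eq   = factorize-concat vs hs (Linked.tail lk)
  s⪯vs = ⪯-⪯head-trans vs (inj₁ (Hall⇒suffix≺ h)) (linked-head lk)

factorize-unique : ∀ {w vs} → HallFactorization w vs → factorize w ≡ vs
factorize-unique {vs = vs} (mkFactorization refl hs lk) = factorize-concat vs hs lk

factorize-Hall : ∀ {w} → IsHall w → factorize w ≡ [ w ]
factorize-Hall h = factorize-unique (mkFactorization (++-identityʳ _) (h ∷ []) [-])

-- Nyldon words are exactly the Hall words.

-- Strong induction on length makes the two notions agree on the factors of any factorization with
-- at least two parts. If `factorize w` had two parts, they would refute that `w` is Nyldon;
-- conversely, for a Hall word such a factorization would contradict the uniqueness of `[ w ]`.
Nyldon⇔Hall : ∀ w → Nyldon w ⇔ IsHall w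
Nyldon⇔Hall w = go w (<-wellFounded (length w))
  where
  go : ∀ w → Acc _<_ (length w) → Nyldon w ⇔ IsHall w
  go w (acc rs) = mk⇔ to from
    where
    open Equivalence using () renaming (to to ⇒; from to ⇐)

    to : Nyldon w → IsHall w
    to n with ⇒ (Nyldon-unfold w) n
    ... | inj₁ 1≡w = short w 1≡w
      where
      short : ∀ w → length w ≡ 1 → IsHall w
      short (c ∷ []) _ = [] , letter c
    ... | inj₂ (2≤w , none) with factorize w | factorize-correct w
    ...   | []           | mkFactorization refl _ _ = contradiction 2≤w λ ()
    ...   | v ∷ []       | mkFactorization refl (h ∷ []) _ =
            subst IsHall (sym (++-identityʳ v)) h
    ...   | v ∷ v' ∷ vs | mkFactorization refl hs lk =
            contradiction
              ( v ∷ v' ∷ vs , s≤s (s≤s z≤n)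
              , mkFactorization refl
                  (All.zipWith (λ (lt , h) → ⇐ (go _ (rs lt)) h)
                    ( factor-< (v ∷ v' ∷ vs) (s≤s (s≤s z≤n))
                        (All.map (λ (_ , h) → Hall⇒nonempty h) hs)
                    , hs))
                  lk)
              none

    from : IsHall w → Nyldon w
    from (_ , letter c) = ⇐ (Nyldon-unfold w) (inj₁ refl)
    from H@(_ , node {u = u} {v = v} hu hv _ _) =
      ⇐ (Nyldon-unfold w) (inj₂ (2≤uv , none))
      where
      2≤uv : 2 ≤ length (u ++ v)
      2≤uv = subst (2 ≤_) (sym (length-++ u))
        (+-mono-≤ (Hall⇒nonempty hu) (Hall⇒nonempty hv))

      none : ¬ (∃[ γs ] 2 ≤ length γs × NyldonFactorization (u ++ v) γs)
      none (γs , 2≤γs , mkFactorization e ns lk) = contradiction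
        (subst (λ γs → 2 ≤ length γs) γs≡ 2≤γs) λ { (s≤s ()) }
        where
        short : All (λ γ → length γ < length w) γs
        short = subst (λ w → All (λ γ → length γ < length w) γs) e
          (factor-< γs 2≤γs (All.map (λ {γ} → Nyldon⇒nonempty γ) ns))
        hs : All IsHall γs
        hs = All.zipWith (λ (lt , n) → ⇒ (go _ (rs lt)) n) (short , ns)
        γs≡ : γs ≡ [ u ++ v ]
        γs≡ = trans (sym (factorize-unique (mkFactorization e hs lk))) (factorize-Hall H)

Nyldon⇒Hall-factorization : ∀ {w γs} → NyldonFactorization w γs → HallFactorization w γs
Nyldon⇒Hall-factorization (mkFactorization e ns lk) =
  mkFactorization e (All.map (λ {γ} → Equivalence.to (Nyldon⇔Hall γ)) ns) lk

Hall⇒Nyldon-factorization : ∀ {w γs} → HallFactorization w γs → NyldonFactorization w γs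
Hall⇒Nyldon-factorization (mkFactorization e hs lk) =
  mkFactorization e (All.map (λ {γ} → Equivalence.from (Nyldon⇔Hall γ)) hs) lk

Hall-factorization-unique : ∀ {w γs δs} →
  HallFactorization w γs → HallFactorization w δs → γs ≡ δs
Hall-factorization-unique f g = trans (sym (factorize-unique f)) (factorize-unique g)

-- Lengthening the last factor and appending a new one.

linked-extend : ∀ ys {y y' z} → Linked _⪯_ (ys ∷ʳ y) → y ⪯ y' → y' ⪯ z →
                Linked _⪯_ (ys ++ y' ∷ z ∷ [])
linked-extend []            _            y⪯y' y'⪯z = y'⪯z ∷ [-]
linked-extend (x ∷ [])      (x⪯y ∷ _)   y⪯y' y'⪯z = ⪯-trans x⪯y y⪯y' ∷ y'⪯z ∷ [-]
linked-extend (_ ∷ x ∷ ys) (x'⪯x ∷ lk) y⪯y' y'⪯z = x'⪯x ∷ linked-extend (x ∷ ys) lk y⪯y' y'⪯z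

-- Lengthening the last factor only makes it larger, so the order with the earlier factors survives.
-- Both factorizations of the theorem arise in this way.
extend-factorization : ∀ {w} ys {y u z} → HallFactorization w (ys ∷ʳ y) →
  IsHall (y ++ u) → IsHall z → y ++ u ⪯ z →
  HallFactorization (w ++ u ++ z) (ys ++ (y ++ u) ∷ z ∷ [])
extend-factorization ys {y} {u} {z} (mkFactorization refl hs lk) hyu hz yu⪯z =
  mkFactorization concat-eq
    (All.++⁺ (All.++⁻ˡ ys hs) (hyu ∷ hz ∷ []))
    (linked-extend ys lk (⪯-++ y u) yu⪯z)
  where
  regroup : ∀ v → v ++ (y ++ u) ++ z ++ [] ≡ (v ++ y ++ []) ++ u ++ z
  regroup v = solve (++-monoid Bool)

  concat-eq : concat (ys ++ (y ++ u) ∷ z ∷ []) ≡ concat (ys ∷ʳ y) ++ u ++ z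
  concat-eq = begin
    concat (ys ++ (y ++ u) ∷ z ∷ [])     ≡⟨ concat-++ ys _ ⟨
    concat ys ++ (y ++ u) ++ z ++ []     ≡⟨ regroup (concat ys) ⟩
    (concat ys ++ y ++ []) ++ u ++ z     ≡⟨ cong (_++ u ++ z) (concat-++ ys _) ⟩
    concat (ys ∷ʳ y) ++ u ++ z           ∎
    where open ≡-Reasoning

-- Block words and their recurrences.

-- The letter b is replaced by a variable word β because the monoid solver treats
-- only variables as atoms.
module Blocks (β T D : Word) where
  B P Q Z Ẑ R T' D' : Word
  B  = β ++ T
  P  = B ++ D
  Q  = P ++ β ++ D
  Z  = B ++ T ++ D
  Ẑ  = Z ++ β
  R  = Z ++ β ++ D
  T' = T ++ D ++ β ++ D ++ β ++ T
  D' = D ++ Z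

module Recurrences (β T D : Word) where
  open Blocks β T D
  open Blocks β T' D' using ()
    renaming (B to B'; P to P'; Q to Q'; Z to Z'; Ẑ to Ẑ'; R to R')

  B-rec : B' ≡ Q ++ B
  B-rec = solve (++-monoid Bool)

  P-rec : P' ≡ Q ++ P ++ Z
  P-rec = solve (++-monoid Bool)

  Z-rec : Z' ≡ (Q ++ R) ++ P ++ Z
  Z-rec = solve (++-monoid Bool)

  Ẑ-rec : Ẑ' ≡ (Q ++ R) ++ P ++ Ẑ
  Ẑ-rec = solve (++-monoid Bool)

  Q-rec : Q' ≡ Q ++ P ++ R ++ Z
  Q-rec = solve (++-monoid Bool)

  R-rec : R' ≡ (Q ++ R) ++ P ++ R ++ Z
  R-rec = solve (++-monoid Bool)

  -- Two Thue-Morse doublings send the pair `T`, `D ++ β` of complementary words to `T'`, `D' ++ β`;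
  -- this equation and `D-rec` justify the choice of `T'` and `D'`.
  T-rec : (T ++ D ++ β) ++ D ++ β ++ T ≡ T'
  T-rec = solve (++-monoid Bool)

  D-rec : (D ++ β ++ T) ++ T ++ D ++ β ≡ D' ++ β
  D-rec = solve (++-monoid Bool)

  PẐ-rec : B ++ D' ++ β ≡ P ++ Ẑ
  PẐ-rec = solve (++-monoid Bool)

  PRZ-rec : (B ++ D' ++ β) ++ D' ≡ P ++ R ++ Z
  PRZ-rec = solve (++-monoid Bool)

-- The blocks are Hall words: inductive step.

-- Only `P`, `Q` and `R` serve as left factors in the recurrences, so only their indices need a
-- bound. The right factors paired with them are all at least `B`, hence one common bound suffices.
record Invariant (T D : Word) : Set where
  open Blocks [ b ] T D
  field
    Hall-B : IsHall B
    Hall-Z : IsHall Z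
    Hall-Ẑ : IsHall Ẑ
    Hall-P : ∃[ s ] Hall s P × s ⪯ B
    Hall-Q : ∃[ s ] Hall s Q × s ⪯ B
    Hall-R : ∃[ s ] Hall s R × s ⪯ B

module Step (t d : Word) (inv : Invariant (a ∷ t) (b ∷ d)) where
  T D : Word
  T = a ∷ t
  D = b ∷ d
  open Blocks [ b ] T D public
  open Blocks [ b ] T' D' using () renaming (B to B')
  open Recurrences [ b ] T D public
  open Invariant inv public

  B⪯Z : B ⪯ Z
  B⪯Z = ⪯-++ B _

  B⪯Ẑ : B ⪯ Ẑ
  B⪯Ẑ = ⪯-++-trans [ b ] B⪯Z

  B⪯R : B ⪯ R
  B⪯R = ⪯-++-trans _ B⪯Z

  B⪯P : B ⪯ P
  B⪯P = ⪯-++ B _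

  -- After the common prefix `B`, `Z` goes on with the `a` of `T` and `P` with the `b` of `D`. A
  -- mismatch is unaffected by appending `x`, which covers `Ẑ`, `R` and `R ++ Z`.
  Z++≺P : ∀ x → Z ++ x ≺ P
  Z++≺P x = next refl
    (subst (_≺ T ++ D) (sym (++-assoc T (T ++ D) x)) (++⁺-≺ T (this f<t)))

  Z≺P : Z ≺ P
  Z≺P = next refl (++⁺-≺ T (this f<t))

  RZ≺P : R ++ Z ≺ P
  RZ≺P = subst (_≺ P) (sym (++-assoc Z _ Z)) (Z++≺P _)

  Z≺R : Z ≺ R
  Z≺R = ≺-++-∷ Z b D

  -- After `P` and one `b`, `Q` has the leading `b` of `D`. The words `P ++ Z`, `P ++ Ẑ` and
  -- `P ++ R ++ Z` all have the form on the left, since `Z` starts with `b` and `T`.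
  Pba≺Q : ∀ x → P ++ b ∷ a ∷ x ≺ Q
  Pba≺Q x = ++⁺-≺ P (next refl (this f<t))

  B≺Q : B ≺ Q
  B≺Q = ≺-++ _ (≺-++-∷ B b d)

  nodeB : ∀ {r u v} → ∃[ s ] Hall s u × s ⪯ B → Hall r v → v ≺ u → B ⪯ v → Hall v (u ++ v)
  nodeB (_ , hu , s⪯B) hv v≺u B⪯v = node hu hv v≺u (⪯-trans s⪯B B⪯v)

  Hall-PZ : Hall Z (P ++ Z)
  Hall-PZ = nodeB Hall-P (proj₂ Hall-Z) Z≺P B⪯Z

  Hall-PẐ : Hall Ẑ (P ++ Ẑ)
  Hall-PẐ = nodeB Hall-P (proj₂ Hall-Ẑ) (Z++≺P [ b ]) B⪯Ẑ

  Hall-PRZ : Hall (R ++ Z) (P ++ R ++ Z)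
  Hall-PRZ = nodeB Hall-P
    (nodeB Hall-R (proj₂ Hall-Z) Z≺R B⪯Z)
    RZ≺P (⪯-++-trans Z B⪯R)

  Hall-QR : Hall R (Q ++ R)
  Hall-QR = nodeB Hall-Q (proj₁ (proj₂ Hall-R)) (≺-++ _ (Z++≺P _)) B⪯R

  R⪯P : R ⪯ P
  R⪯P = inj₁ (Z++≺P _)

  -- `B'` starts with `Q`. The bound serves twice: for the indices of the next `Q` and `R`, and for
  -- the order of the last two factors.
  PRZ⪯B' : P ++ R ++ Z ⪯ B'
  PRZ⪯B' = subst (P ++ R ++ Z ⪯_) (sym B-rec) (inj₁ (≺-++ B (Pba≺Q _)))

  invariant' : Invariant T' D'
  invariant' = record
    { Hall-B = _ , subst (Hall _) (sym B-rec)
        (nodeB Hall-Q (proj₂ Hall-B) B≺Q (inj₂ refl))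
    -- Here the left factor is `Q ++ R`, whose index is `R`, so the condition is a bound by `R`
    -- instead of `B`; it follows from `R ⪯ P`.
    ; Hall-Z = _ , subst (Hall _) (sym Z-rec)
        (node Hall-QR Hall-PZ (≺-++ R (Pba≺Q _)) (⪯-++-trans Z R⪯P))
    ; Hall-Ẑ = _ , subst (Hall _) (sym Ẑ-rec)
        (node Hall-QR Hall-PẐ (≺-++ R (Pba≺Q _)) (⪯-++-trans Ẑ R⪯P))
    ; Hall-P = _ , subst (Hall _) (sym P-rec)
        (nodeB Hall-Q Hall-PZ (Pba≺Q _) (⪯-++-trans Z B⪯P))
        , subst (P ++ Z ⪯_) (sym B-rec) (inj₁ (≺-++ B (Pba≺Q _)))
    ; Hall-Q = _ , subst (Hall _) (sym Q-rec)
        (nodeB Hall-Q Hall-PRZ (Pba≺Q _) (⪯-++-trans _ B⪯P))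
        , PRZ⪯B'
    ; Hall-R = _ , subst (Hall _) (sym R-rec)
        (node Hall-QR Hall-PRZ (≺-++ R (Pba≺Q _)) (⪯-++-trans _ R⪯P))
        , PRZ⪯B'
    }

-- Induction along the Thue-Morse words.

-- Certifies the concrete words of the base case by evaluating `factorize`.
factorize⇒Hall : ∀ w → factorize w ≡ [ w ] → IsHall w
factorize⇒Hall w eq = All.head (subst (All IsHall) eq (factors (factorize-correct w)))

-- For `TM 2` the block `B` is `babba`, and every word to be bounded by it starts with `baa`.
baa≺bab : ∀ {u v} → b ∷ a ∷ a ∷ u ≺ b ∷ a ∷ b ∷ v
baa≺bab = next refl (next refl (this f<t))

-- Holds for n = 2m with m ≥ 1.
record State (n : ℕ) : Set where
  field
    t d           : Word
    TM≡           : TM n ≡ a ∷ t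
    TMᶜ≡          : complement (TM n) ≡ (b ∷ d) ∷ʳ b
    invariant     : Invariant (a ∷ t) (b ∷ d)
    ys            : List Word
    y             : Word
    factorization : HallFactorization (TM (suc n)) (ys ∷ʳ y)
    yD-Hall       : IsHall (y ++ b ∷ d)
    yD⪯B          : y ++ b ∷ d ⪯ b ∷ a ∷ t

state-2 : State 2
state-2 = record
  { t             = b ∷ b ∷ a ∷ []
  ; d             = a ∷ a ∷ []
  ; TM≡           = refl
  ; TMᶜ≡          = refl
  ; invariant     = record
    { Hall-B = factorize⇒Hall _ refl
    ; Hall-Z = factorize⇒Hall _ refl
    ; Hall-Ẑ = factorize⇒Hall _ refl
    ; Hall-P = _ , proj₂ (factorize⇒Hall _ refl) , inj₁ baa≺bab
    ; Hall-Q = _ , proj₂ (factorize⇒Hall _ refl) , inj₁ baa≺bab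
    ; Hall-R = _ , proj₂ (factorize⇒Hall _ refl) , inj₁ baa≺bab
    }
  ; ys            = [ a ] ∷ [ b ] ∷ (b ∷ a ∷ []) ∷ []
  ; y             = b ∷ a ∷ a ∷ b ∷ []
  ; factorization = factorize-correct (TM 3)
  ; yD-Hall       = factorize⇒Hall _ refl
  ; yD⪯B          = inj₁ baa≺bab
  }

complement-involutive : ∀ w → complement (complement w) ≡ w
complement-involutive w =
  trans (sym (map-∘ w)) (trans (map-cong Bool.not-involutive w) (map-id w))

complement-TM : ∀ n → complement (TM (suc n)) ≡ complement (TM n) ++ TM n
complement-TM n = trans (map-++ _ (TM n) _)
  (cong (complement (TM n) ++_) (complement-involutive (TM n)))

dropLast-∷ʳ : ∀ w c → dropLast (w ∷ʳ c) ≡ w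
dropLast-∷ʳ w c = trans
  (cong (λ n → take n (w ∷ʳ c)) (trans (cong (_∸ 1) (length-++ w)) (m+n∸n≡m (length w) 1)))
  (take-++ w)
  where
  take-++ : ∀ w → take (length w) (w ∷ʳ c) ≡ w
  take-++ []      = refl
  take-++ (x ∷ w) = cong (x ∷_) (take-++ w)

module Next {n : ℕ} (state : State n) where
  open State state
  open Step t d invariant

  -- Splitting before the last `b` of the complement shows that `TM (2 + n)` appends `D` and then
  -- `B` to `TM (suc n)`: `D` lengthens `y`, and `B` is the new factor.
  TMᶜ-suc : complement (TM (suc n)) ≡ D ++ b ∷ T
  TMᶜ-suc = trans (complement-TM n)
    (trans (cong₂ _++_ TMᶜ≡ TM≡) (++-assoc D [ b ] T))

  TM-suc : TM (suc n) ≡ T ++ D ∷ʳ b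
  TM-suc = cong₂ _++_ TM≡ TMᶜ≡

  TM-suc² : TM (2 + n) ≡ T'
  TM-suc² = trans (cong₂ _++_ TM-suc TMᶜ-suc) T-rec

  TMᶜ-suc² : complement (TM (2 + n)) ≡ D' ∷ʳ b
  TMᶜ-suc² = trans (complement-TM (suc n)) (trans (cong₂ _++_ TMᶜ-suc TM-suc) D-rec)

  y' : Word
  y' = B ++ complement (TM (2 + n))

  y'≡PẐ : y' ≡ P ++ Ẑ
  y'≡PẐ = trans (cong (B ++_) TMᶜ-suc²) PẐ-rec

  y'D'≡PRZ : y' ++ D' ≡ P ++ R ++ Z
  y'D'≡PRZ = trans (cong (λ w → (B ++ w) ++ D') TMᶜ-suc²) PRZ-rec

  factorization-2+n : HallFactorization (TM (2 + n)) (ys ++ (y ++ D) ∷ B ∷ [])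
  factorization-2+n = factorization-resp
    (cong (TM (suc n) ++_) (sym TMᶜ-suc))
    (extend-factorization ys factorization yD-Hall Hall-B yD⪯B)

  -- Same extension, except that `B` also takes in the whole appended complement and becomes `y'`,
  -- that is `P ++ Ẑ`.
  factorization-3+n : HallFactorization (TM (3 + n)) (ys ++ (y ++ D) ∷ y' ∷ [])
  factorization-3+n = factorization-resp eq
    (extend-factorization ys factorization yD-Hall
      (_ , subst (Hall _) (sym y'≡PẐ) Hall-PẐ) (⪯-++-trans _ yD⪯B))
    where
    regroup : ∀ u v w x → u ++ v ++ w ++ x ≡ (u ++ v ++ w) ++ x
    regroup u v w x = solve (++-monoid Bool)

    eq : TM (suc n) ++ D ++ y' ≡ TM (3 + n)
    eq = trans (regroup (TM (suc n)) D B _)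
      (cong (λ w → (TM (suc n) ++ w) ++ complement (TM (2 + n))) (sym TMᶜ-suc))

  state-2+n : State (2 + n)
  state-2+n = record
    { TM≡           = TM-suc²
    ; TMᶜ≡          = TMᶜ-suc²
    ; invariant     = invariant'
    ; ys            = ys ∷ʳ (y ++ D)
    ; y             = y'
    ; factorization = subst (HallFactorization _) (sym (++-assoc ys _ _)) factorization-3+n
    ; yD-Hall       = _ , subst (Hall _) (sym y'D'≡PRZ) Hall-PRZ
    ; yD⪯B          = subst (_⪯ b ∷ T') (sym y'D'≡PRZ) PRZ⪯B'
    }

  dropLast≡ : dropLast (complement (TM n)) ≡ D
  dropLast≡ = trans (cong dropLast TMᶜ≡) (dropLast-∷ʳ D b)

  factorizations : ∀ {xs x} → HallFactorization (TM (suc n)) (xs ∷ʳ x) →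
    HallFactorization (TM (2 + n))
      (xs ++ (x ++ dropLast (complement (TM n))) ∷ (b ∷ TM n) ∷ []) ×
    HallFactorization (TM (3 + n))
      (xs ++ (x ++ dropLast (complement (TM n)))
           ∷ ((b ∷ TM n) ++ complement (TM (2 + n))) ∷ [])
  factorizations {xs} f
    -- By uniqueness the given factorization is the one stored in the state.
    with refl , refl ← ∷ʳ-injective xs ys (Hall-factorization-unique f factorization)
    rewrite dropLast≡ =
      subst (λ w → HallFactorization (TM (2 + n)) (ys ++ (y ++ D) ∷ (b ∷ w) ∷ []))
        (sym TM≡) factorization-2+n
    , subst (λ w → HallFactorization (TM (3 + n))
                     (ys ++ (y ++ D) ∷ ((b ∷ w) ++ complement (TM (2 + n))) ∷ []))
        (sym TM≡) factorization-3+n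

-- The index is the normal form of 2 * (j + 2) ∸ 2.
state : ∀ j → State (j + suc (suc j + 0))
state zero    = state-2
state (suc j) = subst State (cong suc (sym (+-suc j _))) (Next.state-2+n (state j))

theorem4 : (k : ℕ) → 2 ≤ k →
    (xs : List Word) (x : Word) →
    NyldonFactorization (TM (2 * k ∸ 1)) (xs ∷ʳ x) →
    NyldonFactorization (TM (2 * k))
    (xs ++ (x ++ dropLast (complement (TM (2 * k ∸ 2))))
    ∷ (b ∷ TM (2 * k ∸ 2))
    ∷ []) ×
    NyldonFactorization (TM (2 * k + 1))
    (xs ++ (x ++ dropLast (complement (TM (2 * k ∸ 2))))
    ∷ ((b ∷ TM (2 * k ∸ 2)) ++ complement (TM (2 * k)))
    ∷ [])
theorem4 k@(suc (suc j)) (s≤s (s≤s _)) xs x f =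
  -- `state j` sits at `2 * k ∸ 2`, so its next three words are those of the theorem.
  let f₁ , f₂ = Next.factorizations (state j) (Nyldon⇒Hall-factorization f) in
    Hall⇒Nyldon-factorization f₁
  , factorization-resp (cong TM (+-comm 1 (2 * k))) (Hall⇒Nyldon-factorization f₂)
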